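{- $\mathsf{DNR}_3<^{<\omega}_1\mathsf{DNR}_2$, and $\mathsf{DNR}_3<^1_\omega\mathsf{DNR}_2$.
   Context: $\mathsf{DNR}_k$ is the set of all $k$-valued diagonally noncomputable functions, i.e. all total $f:\mathbb N\to\mathbb N$ with $f(n)<k$ for every $n$ and $f(e)\neq\Phi_e(e)$ whenever $\Phi_e(e)$ converges (here $\Phi_e(e)$ is the value of the $e$-th partial computable function on $\mathbb N$ at $e$). Let also $\{\Phi_e\}_{e\in\mathbb N}$ denote an effective enumeration of all partial computable functions $\Phi_e:\subseteq\mathbb N^{\mathbb N}\to\mathbb N^{\mathbb N}$. A learner is a total computable function $\Psi:\mathbb N^{<\mathbb N}\to\mathbb N$. A partial function $\Gamma:\subseteq\mathbb N^{\mathbb N}\to\mathbb N^{\mathbb N}$ is $(<\omega,1)$-computable if there is $b\in\mathbb N$ such that for every $g\in\mathrm{dom}(\Gamma)$, $\Gamma(g)=\Phi_e(g)$ for some $e<b$. It is $(1,\omega)$-computable if there is a learner $\Psi$ such that for every $g\in\mathrm{dom}(\Gamma)$ the limit $\lim_n\Psi(g\upharpoonright n)$ exists and $\Phi_{\lim_n\Psi(g\upharpoonright n)}(g)=\Gamma(g)$. For $A,B\subseteq\mathbb N^{\mathbb N}$, $A\le^\alpha_\beta B$ means there is an $(\alpha,\beta)$-computable $\Gamma$ with $B\subseteq\mathrm{dom}(\Gamma)$ and $\Gamma(g)\in A$ for every $g\in B$; $A<^\alpha_\beta B$ means $A\le^\alpha_\beta B$ and $B\not\le^\alpha_\beta A$.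 -}

module Defs where

open import Data.Fin using (Fin; zero)
open import Data.List using (List; []; _∷_; applyUpTo)
open import Data.Nat using (ℕ; zero; suc; _+_; _*_; _^_; _≤_; _<_)
open import Data.Product using (∃; ∃-syntax; _×_)
open import Data.Unit using (⊤)
open import Data.Vec using (Vec; []; _∷_; lookup)
open import Function using (_⇔_)
open import Level using (0ℓ)
open import Relation.Binary using (REL; Setoid; _Respectsˡ_; _Respectsʳ_)
open import Relation.Binary.PropositionalEquality using (_≡_; _≢_; setoid; _→-setoid_)
open import Relation.Nullary using (¬_)
open import Relation.Unary using (Pred; _∈_; _⊆_)

ℕₛ : Setoid 0ℓ 0ℓ
ℕₛ = setoid ℕ

-- ℕ^ℕ, with pointwise equality.
𝓝 : Setoid 0ℓ 0ℓ
𝓝 = ℕ →-setoid ℕ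

infix 1 _⇀_

-- Partial functions, given by their graphs; nothing makes the domain decidable.
record _⇀_ (X Y : Setoid 0ℓ 0ℓ) : Set₁ where
  private
    module X = Setoid X
    module Y = Setoid Y
  field
    graph      : REL X.Carrier Y.Carrier 0ℓ
    respˡ      : graph Respectsˡ X._≈_
    respʳ      : graph Respectsʳ Y._≈_
    functional : ∀ {x y y′} → graph x y → graph x y′ → y Y.≈ y′

  dom : Pred X.Carrier 0ℓ
  dom x = ∃[ y ] graph x y

open _⇀_ public

_≐_ : ∀ {X Y} → X ⇀ Y → X ⇀ Y → Set
f ≐ f′ = ∀ x y → graph f x y ⇔ graph f′ x y

-- n-ary μ-recursive functions relative to k oracles ℕ → ℕ.
data μRec (k : ℕ) : ℕ → Set where
  zer    : μRec k 0
  succ   : μRec k 1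
  proj   : ∀ {n} → Fin n → μRec k n
  oracle : Fin k → μRec k 1
  comp   : ∀ {m n} → μRec k m → Vec (μRec k n) m → μRec k n
  prec   : ∀ {n} → μRec k n → μRec k (2 + n) → μRec k (1 + n)
  μ      : ∀ {n} → μRec k (1 + n) → μRec k n

mutual
  -- ⟦ c ⟧ γ xs y : with oracles γ, the computation of c on xs converges to y.
  ⟦_⟧ : ∀ {k n} → μRec k n → Vec (ℕ → ℕ) k → Vec ℕ n → ℕ → Set
  ⟦ zer ⟧       γ []           y = y ≡ 0
  ⟦ succ ⟧      γ (x ∷ [])     y = y ≡ suc x
  ⟦ proj i ⟧    γ xs           y = y ≡ lookup xs i
  ⟦ oracle i ⟧  γ (x ∷ [])     y = y ≡ lookup γ i x
  ⟦ comp c ds ⟧ γ xs           y = ∃[ zs ] (⟦ ds ⟧* γ xs zs × ⟦ c ⟧ γ zs y)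
  ⟦ prec c d ⟧  γ (zero ∷ xs)  y = ⟦ c ⟧ γ xs y
  ⟦ prec c d ⟧  γ (suc i ∷ xs) y = ∃[ r ] (⟦ prec c d ⟧ γ (i ∷ xs) r × ⟦ d ⟧ γ (i ∷ r ∷ xs) y)
  ⟦ μ c ⟧       γ xs           y = ⟦ c ⟧ γ (y ∷ xs) 0 × (∀ i → i < y → ∃[ v ] ⟦ c ⟧ γ (i ∷ xs) (suc v))

  ⟦_⟧* : ∀ {k m n} → Vec (μRec k n) m → Vec (ℕ → ℕ) k → Vec ℕ n → Vec ℕ m → Set
  ⟦ [] ⟧*     γ xs []       = ⊤
  ⟦ d ∷ ds ⟧* γ xs (z ∷ zs) = ⟦ d ⟧ γ xs z × ⟦ ds ⟧* γ xs zs

PartialComputable : Pred (ℕₛ ⇀ ℕₛ) 0ℓ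
PartialComputable f =
  ∃[ c ] (∀ x y → graph f x y ⇔ ⟦ c ⟧ [] (x ∷ []) y)

-- Γ(g) is defined exactly when the computation with oracle g converges on
-- every input n, and Γ(g)(n) is then its result.
PartialComputable𝓝 : Pred (𝓝 ⇀ 𝓝) 0ℓ
PartialComputable𝓝 Γ =
  ∃[ c ] (∀ g h → graph Γ g h ⇔ (∀ n → ⟦ c ⟧ (g ∷ []) (n ∷ []) (h n)))

-- The field universal implies that every φ e is itself partial computable.
record IsEffectiveEnumeration (φ : ℕ → ℕₛ ⇀ ℕₛ) : Set₁ where
  field
    universal : ∃[ u ] (∀ e x y → graph (φ e) x y ⇔ ⟦ u ⟧ [] (e ∷ x ∷ []) y)
    complete  : ∀ f → f ∈ PartialComputable → ∃[ e ] φ e ≐ f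

record IsEffectiveEnumeration𝓝 (Φ : ℕ → 𝓝 ⇀ 𝓝) : Set₁ where
  field
    universal : ∃[ u ] (∀ e g h → graph (Φ e) g h ⇔ (∀ n → ⟦ u ⟧ (g ∷ []) (e ∷ n ∷ []) (h n)))
    complete  : ∀ Γ → Γ ∈ PartialComputable𝓝 → ∃[ e ] Φ e ≐ Γ

DNR : (ℕ → ℕₛ ⇀ ℕₛ) → ℕ → Pred (ℕ → ℕ) 0ℓ
DNR φ k f = (∀ n → f n < k) × (∀ e y → graph (φ e) e y → f e ≢ y)

-- A bijection between finite strings and ℕ.
encode : List ℕ → ℕ
encode []      = 0
encode (x ∷ σ) = 2 ^ x * suc (2 * encode σ)

IsLearner : Pred (List ℕ → ℕ) 0ℓ
IsLearner Ψ = ∃[ c ] (∀ σ → ⟦ c ⟧ [] (encode σ ∷ []) (Ψ σ))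

infix 8 _↾_

_↾_ : (ℕ → ℕ) → ℕ → List ℕ
g ↾ n = applyUpTo g n

-- Convergence in the discrete space ℕ.
Limit : (ℕ → ℕ) → ℕ → Set
Limit s l = ∃[ N ] (∀ n → N ≤ n → s n ≡ l)

-- (<ω,1)-computability
⟨<ω,1⟩-Computable : (ℕ → 𝓝 ⇀ 𝓝) → Pred (𝓝 ⇀ 𝓝) 0ℓ
⟨<ω,1⟩-Computable Φ Γ =
  ∃[ b ] (∀ {g h} → graph Γ g h → ∃[ e ] (e < b × graph (Φ e) g h))

-- (1,ω)-computability
⟨1,ω⟩-Computable : (ℕ → 𝓝 ⇀ 𝓝) → Pred (𝓝 ⇀ 𝓝) 0ℓ
⟨1,ω⟩-Computable Φ Γ =
  ∃[ Ψ ] (IsLearner Ψ ×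
    (∀ {g h} → graph Γ g h → ∃[ e ] (Limit (λ n → Ψ (g ↾ n)) e × graph (Φ e) g h)))

infix 4 _≤[_]_ _<[_]_

-- A ≤[ C ] B is A ≤^α_β B when C is the class of (α,β)-computable functions.
_≤[_]_ : Pred (ℕ → ℕ) 0ℓ → Pred (𝓝 ⇀ 𝓝) 0ℓ → Pred (ℕ → ℕ) 0ℓ → Set₁
A ≤[ C ] B =
  ∃[ Γ ] (Γ ∈ C × B ⊆ dom Γ × (∀ {g h} → g ∈ B → graph Γ g h → h ∈ A))

_<[_]_ : Pred (ℕ → ℕ) 0ℓ → Pred (𝓝 ⇀ 𝓝) 0ℓ → Pred (ℕ → ℕ) 0ℓ → Set₁
A <[ C ] B = A ≤[ C ] B × ¬ (B ≤[ C ] A)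

{-# OPTIONS --safe #-}

-- Suppose finitely many functionals Φ e together send a cylinder of DNR₃ into
-- DNR₂. Give an input x the colour c ∈ {0,1} along g if some of these Φ e has
-- Φ e (g) (x) = c; every g is coloured. If each colour could be avoided by
-- forbidding one value at each place (among them the values of the diagonal of
-- φ), then the third values would avoid both colours and lie in DNR₃, so some
-- colour c is unavoidable, and by compactness such a c can be found from x
-- effectively. Let φ x be the function that finds it, run on its own index x:
-- forbidding the values of the diagonal of φ leaves a g ∈ DNR₃ with Φ e (g)
-- (x) = c = φ x (x) for some e, and this e is of no use in a smaller cylinder.
-- Induction on the number of functionals gives a contradiction. A learner that
-- succeeds on DNR₃ is constant on some cylinder by Baire category.
module Submission where

open import Defs
open import Axiom.ExcludedMiddle using (ExcludedMiddle)
open import Data.Empty using (⊥; ⊥-elim)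
open import Data.Fin using (Fin; zero; suc)
open import Data.List using (List; []; _∷_; filter; length; upTo)
open import Data.List.Membership.Propositional using (find; lose) renaming (_∈_ to _∈ˡ_)
open import Data.List.Membership.Propositional.Properties using (∈-filter⁺; ∈-upTo⁺)
open import Data.List.Properties using (filter-notAll)
open import Data.List.Relation.Unary.Any as Any using (Any; here; there)
open import Data.Nat using (ℕ; zero; suc; pred; _+_; _*_; _∸_; _⊔_; _≤_; _<_; z≤n; s≤s; s≤s⁻¹; _≟_; _<?_)
open import Data.Nat.Properties
open import Data.Product using (∃; ∃-syntax; _×_; _,_; proj₁; proj₂)
open import Data.Sum as Sum using (_⊎_; inj₁; inj₂)
open import Data.Unit using (⊤; tt)
open import Data.Vec using (Vec; []; _∷_; lookup; tabulate; head; tail; map)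
open import Data.Vec.Properties using (lookup-map)
open import Function using (_⇔_; mk⇔; Equivalence; _∘_; id)
open import Level using (0ℓ)
open import Relation.Binary.PropositionalEquality
open import Relation.Nullary using (¬_; Dec; yes; no)
open import Relation.Nullary.Decidable using (¬?; decidable-stable)
open import Relation.Unary using (Pred; _∈_; _⊆_)

open Equivalence using (to; from)

private variable
  k m n : ℕ

-- Total computable functions and recursive relations

natrec : ℕ → (ℕ → ℕ → ℕ) → ℕ → ℕ
natrec z s zero    = z
natrec z s (suc n) = s n (natrec z s n)

ifz : ℕ → ℕ → ℕ → ℕ
ifz zero    a b = a
ifz (suc _) a b = b

record Computable {n} (F : Vec ℕ n → ℕ) : Set where
  constructor mkComputable
  field
    code    : μRec 0 n
    correct : ∀ ρ → ⟦ code ⟧ [] ρ (F ρ)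
open Computable

record Computable* {n m} (Fs : Vec ℕ n → Vec ℕ m) : Set where
  constructor mkComputable*
  field component : ∀ j → Computable (λ ρ → lookup (Fs ρ) j)
open Computable*

-- Truth is coded by 0, the value that `μ` searches for; conjunction then becomes a sum.
Recursive : (Vec ℕ n → Set) → Set
Recursive P = ∃[ F ] (Computable F × (∀ ρ → F ρ ≡ 0 ⇔ P ρ))

-- Closure properties of computable functions

-- The semantics is a relation at each input, so pointwise equality suffices. This transfers
-- computability from the combinators to functions defined by pattern matching.
≗-computable : {F G : Vec ℕ n → ℕ} → (∀ ρ → F ρ ≡ G ρ) → Computable F → Computable G
≗-computable eq (mkComputable c p) = mkComputable c λ ρ → subst (⟦ c ⟧ [] ρ) (eq ρ) (p ρ)

⟦tabulate⟧* : (ds : Fin m → μRec k n) {γ : Vec (ℕ → ℕ) k} {xs : Vec ℕ n} (zs : Vec ℕ m) →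
  (∀ j → ⟦ ds j ⟧ γ xs (lookup zs j)) → ⟦ tabulate ds ⟧* γ xs zs
⟦tabulate⟧* ds []       p = tt
⟦tabulate⟧* ds (z ∷ zs) p = p zero , ⟦tabulate⟧* (ds ∘ suc) zs (p ∘ suc)

comp-computable : {G : Vec ℕ m → ℕ} {Fs : Vec ℕ n → Vec ℕ m} →
  Computable G → Computable* Fs → Computable (λ ρ → G (Fs ρ))
comp-computable {Fs = Fs} (mkComputable c p) (mkComputable* q) = mkComputable
  (comp c (tabulate (code ∘ q)))
  (λ ρ → Fs ρ , ⟦tabulate⟧* (code ∘ q) (Fs ρ) (λ j → correct (q j) ρ) , p (Fs ρ))

lookup-computable : (j : Fin n) → Computable (λ ρ → lookup ρ j)
lookup-computable j = mkComputable (proj j) λ ρ → refl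

id-computable* : Computable* {n} id
id-computable* = mkComputable* lookup-computable

lookup-tail : (xs : Vec ℕ (suc n)) (j : Fin n) → lookup xs (suc j) ≡ lookup (tail xs) j
lookup-tail (x ∷ xs) j = refl

lookup-zero : (xs : Vec ℕ (suc n)) → lookup xs zero ≡ head xs
lookup-zero (x ∷ xs) = refl

var₀ : Computable {suc n} head
var₀ = ≗-computable lookup-zero (lookup-computable zero)

tail-computable* : {Fs : Vec ℕ n → Vec ℕ (suc m)} → Computable* Fs → Computable* (tail ∘ Fs)
tail-computable* {Fs = Fs} (mkComputable* q) =
  mkComputable* λ j → ≗-computable (λ ρ → lookup-tail (Fs ρ) j) (q (suc j))

cons-computable* : {F : Vec ℕ n → ℕ} {Fs : Vec ℕ n → Vec ℕ m} →
  Computable F → Computable* Fs → Computable* (λ ρ → F ρ ∷ Fs ρ)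
cons-computable* p q = mkComputable* λ { zero → p ; (suc j) → component q j }

weaken : {F : Vec ℕ n → ℕ} → Computable F → Computable (λ ρ → F (tail ρ))
weaken p = comp-computable p (tail-computable* id-computable*)

weaken* : {Fs : Vec ℕ n → Vec ℕ m} → Computable* Fs → Computable* (λ ρ → Fs (tail ρ))
weaken* q = mkComputable* λ j → weaken (component q j)

var₁ : Computable {suc (suc n)} (λ ρ → head (tail ρ))
var₁ = weaken var₀

suc-computable : {F : Vec ℕ n → ℕ} → Computable F → Computable (λ ρ → suc (F ρ))
suc-computable (mkComputable c p) = mkComputable (comp succ (c ∷ [])) λ ρ → _ ∷ [] , (p ρ , tt) , refl

const-computable : ∀ k → Computable {n} (λ _ → k)
const-computable zero    = mkComputable (comp zer []) λ ρ → [] , tt , refl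
const-computable (suc k) = suc-computable (const-computable k)

-- The step finds the counter and the previous value at the front of its environment, in the order
-- in which `prec` supplies them.
natrec-computable : {B K : Vec ℕ n → ℕ} {S : ℕ → ℕ → Vec ℕ n → ℕ} →
  Computable B → Computable (λ ρ → S (head ρ) (head (tail ρ)) (tail (tail ρ))) → Computable K →
  Computable (λ ρ → natrec (B ρ) (λ i r → S i r ρ) (K ρ))
natrec-computable {n} {B} {K} {S} (mkComputable b p) (mkComputable s q) k =
  comp-computable (mkComputable (prec b s) correct′) (cons-computable* k id-computable*)
  where
  correctᵢ : ∀ i ρ → ⟦ prec b s ⟧ [] (i ∷ ρ) (natrec (B ρ) (λ i r → S i r ρ) i)
  correctᵢ zero    ρ = p ρ
  correctᵢ (suc i) ρ = _ , correctᵢ i ρ , q (i ∷ _ ∷ ρ)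

  correct′ : ∀ ρ → ⟦ prec b s ⟧ [] ρ (natrec (B (tail ρ)) (λ i r → S i r (tail ρ)) (head ρ))
  correct′ (i ∷ ρ) = correctᵢ i ρ

ifz-computable : {F A B : Vec ℕ n → ℕ} → Computable F → Computable A → Computable B →
  Computable (λ ρ → ifz (F ρ) (A ρ) (B ρ))
ifz-computable {F = F} f a b =
  ≗-computable (λ ρ → lemma (F ρ)) (natrec-computable a (weaken (weaken b)) f)
  where
  lemma : ∀ n {a b} → natrec a (λ _ _ → b) n ≡ ifz n a b
  lemma zero    = refl
  lemma (suc n) = refl

pred-computable : {F : Vec ℕ n → ℕ} → Computable F → Computable (λ ρ → pred (F ρ))
pred-computable {F = F} f =
  ≗-computable (λ ρ → lemma (F ρ)) (natrec-computable (const-computable 0) var₀ f)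
  where
  lemma : ∀ n → natrec 0 (λ i _ → i) n ≡ pred n
  lemma zero    = refl
  lemma (suc n) = refl

+-computable : {F G : Vec ℕ n → ℕ} → Computable F → Computable G → Computable (λ ρ → F ρ + G ρ)
+-computable {F = F} f g =
  ≗-computable (λ ρ → lemma (F ρ)) (natrec-computable g (suc-computable var₁) f)
  where
  lemma : ∀ m {n} → natrec n (λ _ r → suc r) m ≡ m + n
  lemma zero    = refl
  lemma (suc m) = cong suc (lemma m)

∸-computable : {F G : Vec ℕ n → ℕ} → Computable F → Computable G → Computable (λ ρ → F ρ ∸ G ρ)
∸-computable {G = G} f g =
  ≗-computable (λ ρ → lemma (G ρ)) (natrec-computable f (pred-computable var₁) g)
  where
  lemma : ∀ n {m} → natrec m (λ _ r → pred r) n ≡ m ∸ n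
  lemma zero        = refl
  lemma (suc n) {m} = trans (cong pred (lemma n)) (pred[m∸n]≡m∸[1+n] m n)

-- Closure properties of recursive relations

≤-recursive : {F G : Vec ℕ n → ℕ} → Computable F → Computable G → Recursive (λ ρ → F ρ ≤ G ρ)
≤-recursive f g = _ , ∸-computable f g , λ ρ → mk⇔ m∸n≡0⇒m≤n m≤n⇒m∸n≡0

×-recursive : {P Q : Vec ℕ n → Set} → Recursive P → Recursive Q → Recursive (λ ρ → P ρ × Q ρ)
×-recursive (F , f , p) (G , g , q) = _ , +-computable f g , λ ρ → mk⇔
  (λ e → to (p ρ) (m+n≡0⇒m≡0 (F ρ) e) , to (q ρ) (m+n≡0⇒n≡0 (F ρ) e))
  (λ (x , y) → cong₂ _+_ (from (p ρ) x) (from (q ρ) y))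

→-recursive : {P Q : Vec ℕ n → Set} → Recursive P → Recursive Q → Recursive (λ ρ → P ρ → Q ρ)
→-recursive {P = P} {Q} (F , f , p) (G , g , q) =
  _ , ifz-computable f g (const-computable 0) , λ ρ → lemma (F ρ) (p ρ) (q ρ)
  where
  lemma : ∀ x {y} {P Q : Set} → x ≡ 0 ⇔ P → y ≡ 0 ⇔ Q → ifz x y 0 ≡ 0 ⇔ (P → Q)
  lemma zero    p q = mk⇔ (λ e _ → to q e) (λ h → from q (h (to p refl)))
  lemma (suc x) p q = mk⇔ (λ _ h → ⊥-elim (1+n≢0 (from p h))) (λ _ → refl)

⊥-recursive : Recursive {n} (λ _ → ⊥)
⊥-recursive = _ , const-computable 1 , λ ρ → mk⇔ (λ ()) (λ ())

⊎-recursive : {P Q : Vec ℕ n → Set} → Recursive P → Recursive Q → Recursive (λ ρ → P ρ ⊎ Q ρ)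
⊎-recursive (F , f , p) (G , g , q) =
  _ , ifz-computable f (const-computable 0) g , λ ρ → lemma (F ρ) (p ρ) (q ρ)
  where
  lemma : ∀ x {y} {P Q : Set} → x ≡ 0 ⇔ P → y ≡ 0 ⇔ Q → ifz x 0 y ≡ 0 ⇔ (P ⊎ Q)
  lemma zero    p q = mk⇔ (λ _ → inj₁ (to p refl)) (λ _ → refl)
  lemma (suc x) p q = mk⇔ (λ e → inj₂ (to q e))
    λ { (inj₁ h) → ⊥-elim (1+n≢0 (from p h)) ; (inj₂ h) → from q h }

⇔-recursive : {P Q : Vec ℕ n → Set} → (∀ ρ → P ρ ⇔ Q ρ) → Recursive P → Recursive Q
⇔-recursive pq (F , f , p) = F , f , λ ρ → mk⇔ (to (pq ρ) ∘ to (p ρ)) (from (p ρ) ∘ from (pq ρ))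

≡-recursive : {F G : Vec ℕ n → ℕ} → Computable F → Computable G → Recursive (λ ρ → F ρ ≡ G ρ)
≡-recursive f g = ⇔-recursive
  (λ ρ → mk⇔ (λ (p , q) → ≤-antisym p q) (λ e → ≤-reflexive e , ≤-reflexive (sym e)))
  (×-recursive (≤-recursive f g) (≤-recursive g f))

¬-recursive : {P : Vec ℕ n → Set} → Recursive P → Recursive (λ ρ → ¬ P ρ)
¬-recursive p = →-recursive p ⊥-recursive

-- A bounded sum of truth values is 0 exactly when each of them is.
∀<-recursive : {K : Vec ℕ n → ℕ} {P : ℕ → Vec ℕ n → Set} →
  Computable K → Recursive (λ ρ → P (head ρ) (tail ρ)) →
  Recursive (λ ρ → ∀ i → i < K ρ → P i ρ)
∀<-recursive {K = K} {P} κ (F , f , p) =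
  _ , natrec-computable {S = λ i r ρ → r + F (i ∷ ρ)} (const-computable 0)
        (+-computable var₁
          (comp-computable f (cons-computable* var₀ (weaken* (weaken* id-computable*))))) κ ,
  λ ρ → mk⇔ (sound ρ (K ρ)) (complete ρ (K ρ))
  where
  sound : ∀ ρ k → natrec 0 (λ i r → r + F (i ∷ ρ)) k ≡ 0 → ∀ i → i < k → P i ρ
  sound ρ (suc k) e i i<k with m<1+n⇒m<n∨m≡n i<k
  ... | inj₁ i<k′ = sound ρ k (m+n≡0⇒m≡0 _ e) i i<k′
  ... | inj₂ refl = to (p (k ∷ ρ)) (m+n≡0⇒n≡0 (natrec 0 _ k) e)

  complete : ∀ ρ k → (∀ i → i < k → P i ρ) → natrec 0 (λ i r → r + F (i ∷ ρ)) k ≡ 0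
  complete ρ zero    h = refl
  complete ρ (suc k) h =
    cong₂ _+_ (complete ρ k λ i i<k → h i (m<n⇒m<1+n i<k)) (from (p (k ∷ ρ)) (h k ≤-refl))

recursive-dec : {P : Vec ℕ n → Set} → Recursive P → ∀ ρ → Dec (P ρ)
recursive-dec (F , f , p) ρ with F ρ ≟ 0
... | yes e = yes (to (p ρ) e)
... | no ¬e = no (¬e ∘ from (p ρ))

-- De Morgan's law, which is constructive here because the range is finite and `P` is decidable.
∃<-recursive : {K : Vec ℕ n → ℕ} {P : ℕ → Vec ℕ n → Set} →
  Computable K → Recursive (λ ρ → P (head ρ) (tail ρ)) →
  Recursive (λ ρ → ∃[ i ] (i < K ρ × P i ρ))
∃<-recursive {K = K} {P} κ p = ⇔-recursive
  (λ ρ → mk⇔ (λ h → decidable-stable (anyUpTo? (λ i → recursive-dec p (i ∷ ρ)) (K ρ))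
                       (λ ¬∃ → h λ i i<K Pi → ¬∃ (i , i<K , Pi)))
             (λ (i , i<K , Pi) h → h i i<K Pi))
  (¬-recursive (∀<-recursive κ (¬-recursive p)))

Any-recursive : {P : ℕ → Vec ℕ n → Set} → (∀ e → Recursive (P e)) → ∀ es →
  Recursive (λ ρ → Any (λ e → P e ρ) es)
Any-recursive p []       = ⇔-recursive (λ ρ → mk⇔ (λ ()) (λ ())) ⊥-recursive
Any-recursive p (e ∷ es) = ⇔-recursive
  (λ ρ → mk⇔ (λ { (inj₁ h) → here h ; (inj₂ h) → there h })
             (λ { (here h) → inj₁ h ; (there h) → inj₂ h }))
  (⊎-recursive (p e) (Any-recursive p es))

-- Unbounded search

μ-least : {P : Vec ℕ (suc n) → Set} → Recursive P →
  ∃[ c ] (∀ ρ → ∃[ s ] P (s ∷ ρ) → ∃[ s ] (P (s ∷ ρ) × ⟦ c ⟧ [] ρ s))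
μ-least {P = P} (F , mkComputable c p , q) = μ c , λ ρ (s , Ps) →
  go ρ s 0 (subst (λ i → P (i ∷ ρ)) (sym (+-identityʳ s)) Ps) λ _ ()
  where
  F≡ : ∀ ρ {v} → F ρ ≡ v → ⟦ c ⟧ [] ρ v
  F≡ ρ e = subst (⟦ c ⟧ [] ρ) e (p ρ)

  -- A solution is known at `d + s`; recursion on the distance `d` shows that the search ends.
  go : ∀ ρ d s → P (d + s ∷ ρ) → (∀ i → i < s → ∃[ v ] ⟦ c ⟧ [] (i ∷ ρ) (suc v)) →
    ∃[ s ] (P (s ∷ ρ) × ⟦ μ c ⟧ [] ρ s)
  go ρ d s Pds below with F (s ∷ ρ) in eq
  ... | zero = s , to (q (s ∷ ρ)) eq , F≡ _ eq , below
  go ρ zero    s Pds below | suc v = ⊥-elim (1+n≢0 (trans (sym eq) (from (q (s ∷ ρ)) Pds)))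
  go ρ (suc d) s Pds below | suc v =
    go ρ d (suc s) (subst (λ i → P (i ∷ ρ)) (sym (+-suc d s)) Pds) below′
    where
    below′ : ∀ i → i < suc s → ∃[ v ] ⟦ c ⟧ [] (i ∷ ρ) (suc v)
    below′ i i<1+s with m<1+n⇒m<n∨m≡n i<1+s
    ... | inj₁ i<s  = below i i<s
    ... | inj₂ refl = v , F≡ _ eq

-- Search for an `s` at which one of the two relations holds, then test which; 0 has priority. The
-- code has to converge only where such an `s` exists.
select : {R : ℕ → ℕ → ℕ → Set} →
  (∀ c → Recursive {2} (λ ρ → R (head ρ) c (head (tail ρ)))) →
  ∃[ d ] (∀ x → ∃[ s ] (R s 0 x ⊎ R s 1 x) → ∃[ c ] (⟦ d ⟧ [] (x ∷ []) c × ∃[ s ] R s c x))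
select {R} r with r 0 | μ-least (⊎-recursive (r 0) (r 1))
... | F , f , p | d , least = comp (code out) (d ∷ proj zero ∷ []) , selects
  where
  out : Computable (λ ρ → ifz (F ρ) 0 1)
  out = ifz-computable f (const-computable 0) (const-computable 1)

  choose : ∀ s x → R s 0 x ⊎ R s 1 x → R s (ifz (F (s ∷ x ∷ [])) 0 1) x
  choose s x h with F (s ∷ x ∷ []) in eq | h
  ... | zero  | _       = to (p _) eq
  ... | suc _ | inj₂ r₁ = r₁
  ... | suc _ | inj₁ r₀ = ⊥-elim (1+n≢0 (trans (sym eq) (from (p _) r₀)))

  selects : ∀ x → ∃[ s ] (R s 0 x ⊎ R s 1 x) →
    ∃[ c ] (⟦ comp (code out) (d ∷ proj zero ∷ []) ⟧ [] (x ∷ []) c × ∃[ s ] R s c x)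
  selects x h with least (x ∷ []) h
  ... | s , Rs , ds = _ , (s ∷ x ∷ [] , (ds , refl , tt) , correct out (_ ∷ _ ∷ [])) , s , choose s x Rs

-- Evaluation with bounded time

-- The outcome of a computation is coded by 0 if it has not converged, and by
-- suc y if it has converged to y.

guard : ℕ → ℕ → ℕ
guard r z = ifz r 0 z

guards : Vec ℕ m → ℕ → ℕ
guards []       z = z
guards (r ∷ rs) z = guard r (guards rs z)

-- 0 while v i > 1 for all smaller i, 2 + i once v i ≡ 1, and 1 if v i ≡ 0 comes first.
search : (ℕ → ℕ) → ℕ → ℕ
search v = natrec 0 (λ i r → ifz r (ifz (v i) 1 (ifz (pred (v i)) (2 + i) 0)) r)

-- Within time s, oracles are queried only below s.
mutual
  eval : μRec k n → ℕ → Vec (ℕ → ℕ) k → Vec ℕ n → ℕ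
  eval zer         s γ xs = 1
  eval succ        s γ xs = 2 + head xs
  eval (proj i)    s γ xs = suc (lookup xs i)
  eval (oracle i)  s γ xs = ifz (suc (head xs) ∸ s) (suc (lookup γ i (head xs))) 0
  eval (comp c ds) s γ xs = guards (eval* ds s γ xs) (eval c s γ (map pred (eval* ds s γ xs)))
  eval (prec c d)  s γ xs =
    natrec (eval c s γ (tail xs)) (λ i r → guard r (eval d s γ (i ∷ pred r ∷ tail xs))) (head xs)
  eval (μ c)       s γ xs = pred (search (λ i → eval c s γ (i ∷ xs)) s)

  eval* : Vec (μRec k n) m → ℕ → Vec (ℕ → ℕ) k → Vec ℕ n → Vec ℕ m
  eval* []       s γ xs = []
  eval* (d ∷ ds) s γ xs = eval d s γ xs ∷ eval* ds s γ xs

-- Soundness, monotonicity and completeness of the bounded evaluation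

guard⁻ : ∀ r {z y} → guard r z ≡ suc y → r ≡ suc (pred r) × z ≡ suc y
guard⁻ (suc r) e = refl , e

guards⁻ : (rs : Vec ℕ m) {z y : ℕ} → guards rs z ≡ suc y → rs ≡ map suc (map pred rs) × z ≡ suc y
guards⁻ []       e = refl , e
guards⁻ (r ∷ rs) e with guard⁻ r e
... | p , e′ with guards⁻ rs e′
... | q , e″ = cong₂ _∷_ p q , e″

guards-suc : (rs : Vec ℕ m) {z : ℕ} → guards (map suc rs) z ≡ z
guards-suc []       = refl
guards-suc (r ∷ rs) = guards-suc rs

map-pred-suc : (rs : Vec ℕ m) → map pred (map suc rs) ≡ rs
map-pred-suc []       = refl
map-pred-suc (r ∷ rs) = cong (r ∷_) (map-pred-suc rs)

module _ (v : ℕ → ℕ) where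

  search-zero : ∀ s → search v s ≡ 0 → ∀ i → i < s → ∃[ w ] v i ≡ 2 + w
  search-zero (suc s) e i i<1+s with search v s in eq | m<1+n⇒m<n∨m≡n i<1+s
  ... | zero | inj₁ i<s = search-zero s eq i i<s
  ... | zero | inj₂ refl with v i
  ...   | suc (suc w) = w , refl

  search-found : ∀ s {y} → pred (search v s) ≡ suc y →
    y < s × v y ≡ 1 × (∀ i → i < y → ∃[ w ] v i ≡ 2 + w)
  search-found (suc s) e with search v s in eq
  ... | suc r with search-found s (trans (cong pred eq) e)
  ...   | y<s , p , q = m<n⇒m<1+n y<s , p , q
  search-found (suc s) e | zero with v s in eq′
  ...   | 1 with refl ← e = ≤-refl , eq′ , search-zero s eq

  search-below : ∀ s → (∀ i → i < s → ∃[ w ] v i ≡ 2 + w) → search v s ≡ 0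
  search-below zero    h = refl
  search-below (suc s) h
    rewrite search-below s (λ i i<s → h i (m<n⇒m<1+n i<s)) | proj₂ (h s ≤-refl) = refl

  search-find : ∀ {y} → v y ≡ 1 → (∀ i → i < y → ∃[ w ] v i ≡ 2 + w) →
    ∀ s → y < s → search v s ≡ 2 + y
  search-find {y} e h (suc s) y<1+s with m<1+n⇒m<n∨m≡n y<1+s
  ... | inj₁ y<s rewrite search-find e h s y<s = refl
  ... | inj₂ refl rewrite search-below s h | e = refl

mutual
  eval-sound : (c : μRec k n) {s : ℕ} {γ : Vec (ℕ → ℕ) k} (xs : Vec ℕ n) {y : ℕ} →
    eval c s γ xs ≡ suc y → ⟦ c ⟧ γ xs y
  eval-sound zer        []       refl = refl
  eval-sound succ       (x ∷ []) refl = refl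
  eval-sound (proj i)   xs       refl = refl
  eval-sound (oracle i) {s} (x ∷ []) e with suc x ∸ s | e
  ... | zero | refl = refl
  eval-sound (comp c ds) {s} {γ} xs e with guards⁻ (eval* ds s γ xs) e
  ... | p , e′ = _ , eval*-sound ds xs p , eval-sound c _ e′
  eval-sound (prec c d) {s} {γ} (i ∷ xs) e = go i e
    where
    go : ∀ i {y} → eval (prec c d) s γ (i ∷ xs) ≡ suc y → ⟦ prec c d ⟧ γ (i ∷ xs) y
    go zero    e = eval-sound c xs e
    go (suc i) e with guard⁻ (eval (prec c d) s γ (i ∷ xs)) e
    ... | p , e′ = _ , go i p , eval-sound d _ e′
  eval-sound (μ c) {s} xs e with search-found _ s e
  ... | _ , p , q = eval-sound c _ p , λ i i<y → proj₁ (q i i<y) , eval-sound c _ (proj₂ (q i i<y))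

  eval*-sound : (ds : Vec (μRec k n) m) {s : ℕ} {γ : Vec (ℕ → ℕ) k} (xs : Vec ℕ n) {zs : Vec ℕ m} →
    eval* ds s γ xs ≡ map suc zs → ⟦ ds ⟧* γ xs zs
  eval*-sound []       xs {[]}     e = tt
  eval*-sound (d ∷ ds) xs {z ∷ zs} e =
    eval-sound d xs (cong head e) , eval*-sound ds xs (cong tail e)

Agree : ℕ → Vec (ℕ → ℕ) k → Vec (ℕ → ℕ) k → Set
Agree s γ δ = ∀ j i → i < s → lookup γ j i ≡ lookup δ j i

module _ {γ δ : Vec (ℕ → ℕ) k} {s t : ℕ} (s≤t : s ≤ t) (γ≈δ : Agree s γ δ) where
 mutual
  -- The use principle: a computation that converges within time `s` queries no oracle at or beyond
  -- `s`, so neither more time nor a change of the oracles there affects its value.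
  eval-mono : (c : μRec k n) (xs : Vec ℕ n) {y : ℕ} → eval c s γ xs ≡ suc y → eval c t δ xs ≡ suc y
  eval-mono zer        xs e = e
  eval-mono succ       xs e = e
  eval-mono (proj i)   xs e = e
  eval-mono (oracle i) xs e with suc (head xs) ∸ s in eq | e
  ... | zero | refl rewrite m≤n⇒m∸n≡0 (≤-trans (m∸n≡0⇒m≤n eq) s≤t) =
    cong suc (sym (γ≈δ i (head xs) (m∸n≡0⇒m≤n eq)))
  eval-mono (comp c ds) xs e with guards⁻ (eval* ds s γ xs) e
  ... | p , e′ rewrite eval*-mono ds xs p
                     | map-pred-suc (map pred (eval* ds s γ xs)) =
    trans (guards-suc (map pred (eval* ds s γ xs))) (eval-mono c _ e′)
  eval-mono (prec c d) xs e = go (head xs) e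
    where
    E : ℕ → Vec (ℕ → ℕ) k → ℕ → ℕ
    E s γ = natrec (eval c s γ (tail xs)) (λ i r → guard r (eval d s γ (i ∷ pred r ∷ tail xs)))

    go : ∀ i {y} → E s γ i ≡ suc y → E t δ i ≡ suc y
    go zero    e = eval-mono c _ e
    go (suc i) e with guard⁻ (E s γ i) e
    ... | p , e′ rewrite go i p = eval-mono d _ e′
  eval-mono (μ c) xs e with search-found _ s e
  ... | y<s , p , q = cong pred (search-find _ (eval-mono c _ p)
    (λ i i<y → proj₁ (q i i<y) , eval-mono c _ (proj₂ (q i i<y))) t (≤-trans y<s s≤t))

  eval*-mono : (ds : Vec (μRec k n) m) (xs : Vec ℕ n) {zs : Vec ℕ m} →
    eval* ds s γ xs ≡ map suc zs → eval* ds t δ xs ≡ map suc zs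
  eval*-mono []       xs {[]}     e = refl
  eval*-mono (d ∷ ds) xs {z ∷ zs} e =
    cong₂ _∷_ (eval-mono d xs (cong head e)) (eval*-mono ds xs (cong tail e))

module _ {γ : Vec (ℕ → ℕ) k} where

  eval-later : (c : μRec k n) {xs : Vec ℕ n} {s t y : ℕ} → s ≤ t →
    eval c s γ xs ≡ suc y → eval c t γ xs ≡ suc y
  eval-later c s≤t = eval-mono s≤t (λ _ _ _ → refl) c _

  eval*-later : (ds : Vec (μRec k n) m) {xs : Vec ℕ n} {s t : ℕ} {zs : Vec ℕ m} → s ≤ t →
    eval* ds s γ xs ≡ map suc zs → eval* ds t γ xs ≡ map suc zs
  eval*-later ds s≤t = eval*-mono s≤t (λ _ _ _ → refl) ds _

  -- The maximum of finitely many times is a common time. The case of `μ` needs one time for all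
  -- smaller arguments.
  eval-bounded : (c : μRec k (suc n)) {xs : Vec ℕ n} → ∀ y →
    (∀ i → i < y → ∃[ v ] ∃[ s ] eval c s γ (i ∷ xs) ≡ suc (suc v)) →
    ∃[ s ] (∀ i → i < y → ∃[ v ] eval c s γ (i ∷ xs) ≡ suc (suc v))
  eval-bounded c zero    h = 0 , λ _ ()
  eval-bounded c {xs} (suc y) h
    with eval-bounded c y (λ i i<y → h i (m<n⇒m<1+n i<y)) | h y ≤-refl
  ... | s , p | v , t , e = s ⊔ t , both
    where
    both : ∀ i → i < suc y → ∃[ v ] eval c (s ⊔ t) γ (i ∷ xs) ≡ suc (suc v)
    both i i<1+y with m<1+n⇒m<n∨m≡n i<1+y
    ... | inj₁ i<y  = proj₁ (p i i<y) , eval-later c (m≤m⊔n s t) (proj₂ (p i i<y))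
    ... | inj₂ refl = v , eval-later c (m≤n⊔m s t) e

  mutual
    eval-complete : (c : μRec k n) (xs : Vec ℕ n) {y : ℕ} →
      ⟦ c ⟧ γ xs y → ∃[ s ] eval c s γ xs ≡ suc y
    eval-complete zer         []       refl = 0 , refl
    eval-complete succ        (x ∷ []) refl = 0 , refl
    eval-complete (proj i)    xs       refl = 0 , refl
    eval-complete (oracle i)  (x ∷ []) refl = suc x , cong (λ r → ifz r (suc (lookup γ i x)) 0) (n∸n≡0 x)
    eval-complete (comp c ds) xs (zs , p , q) with eval*-complete ds xs p | eval-complete c zs q
    ... | s , e | t , e′ = s ⊔ t , lemma (eval*-later ds (m≤m⊔n s t) e)
      where
      lemma : ∀ {rs} → rs ≡ map suc zs → guards rs (eval c (s ⊔ t) γ (map pred rs)) ≡ suc _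
      lemma refl rewrite map-pred-suc zs =
        trans (guards-suc zs) (eval-later c (m≤n⊔m s t) e′)
    eval-complete (prec c d) (zero ∷ xs)  p = eval-complete c xs p
    eval-complete (prec c d) (suc i ∷ xs) (r , p , q)
      with eval-complete (prec c d) (i ∷ xs) p | eval-complete d (i ∷ r ∷ xs) q
    ... | s , e | t , e′ = s ⊔ t ,
      trans (cong (λ r → guard r (eval d (s ⊔ t) γ (i ∷ pred r ∷ xs)))
                  (eval-later (prec c d) {i ∷ xs} (m≤m⊔n s t) e))
            (eval-later d {i ∷ r ∷ xs} (m≤n⊔m s t) e′)
    eval-complete (μ c) xs {y} (p , q)
      with eval-complete c (y ∷ xs) p
         | eval-bounded c y (λ i i<y → proj₁ (q i i<y) , eval-complete c (i ∷ xs) (proj₂ (q i i<y)))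
    ... | s , e | t , h = u , cong pred (search-find (λ i → eval c u γ (i ∷ xs)) (eval-later c s≤u e)
        (λ i i<y → proj₁ (h i i<y) , eval-later c t≤u (proj₂ (h i i<y))) u
        (m≤n⊔m (s ⊔ t) (suc y)))
      where
      -- `search` tests only arguments below its bound, so the time must also exceed `y`.
      u = s ⊔ t ⊔ suc y
      s≤u = ≤-trans (m≤m⊔n s t) (m≤m⊔n (s ⊔ t) (suc y))
      t≤u = ≤-trans (m≤n⊔m s t) (m≤m⊔n (s ⊔ t) (suc y))

    eval*-complete : (ds : Vec (μRec k n) m) (xs : Vec ℕ n) {zs : Vec ℕ m} →
      ⟦ ds ⟧* γ xs zs → ∃[ s ] eval* ds s γ xs ≡ map suc zs
    eval*-complete []       xs {[]}     p = 0 , refl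
    eval*-complete (d ∷ ds) xs {z ∷ zs} (p , q) with eval-complete d xs p | eval*-complete ds xs q
    ... | s , e | t , e′ =
      s ⊔ t , cong₂ _∷_ (eval-later d (m≤m⊔n s t) e) (eval*-later ds (m≤n⊔m s t) e′)

  -- Both computations converge within a common time, at which `eval` has a single value.
  ⟦⟧-functional : (c : μRec k n) {xs : Vec ℕ n} {y z : ℕ} → ⟦ c ⟧ γ xs y → ⟦ c ⟧ γ xs z → y ≡ z
  ⟦⟧-functional c p q with eval-complete c _ p | eval-complete c _ q
  ... | s , e | t , e′ = suc-injective
    (trans (sym (eval-later c (m≤m⊔n s t) e)) (eval-later c (m≤n⊔m s t) e′))

-- Computability of the bounded evaluation

guards-computable : {Rs : Vec ℕ n → Vec ℕ m} {Z : Vec ℕ n → ℕ} →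
  Computable* Rs → Computable Z → Computable (λ ρ → guards (Rs ρ) (Z ρ))
guards-computable {m = zero} {Rs} q z = ≗-computable (λ ρ → lemma (Rs ρ)) z
  where
  lemma : (rs : Vec ℕ 0) {z : ℕ} → z ≡ guards rs z
  lemma [] = refl
guards-computable {m = suc m} {Rs} q z =
  ≗-computable (λ ρ → lemma (Rs ρ))
    (ifz-computable (component q zero) (const-computable 0) (guards-computable (tail-computable* q) z))
  where
  lemma : (rs : Vec ℕ (suc m)) {z : ℕ} → guard (lookup rs zero) (guards (tail rs) z) ≡ guards rs z
  lemma (r ∷ rs) = refl

-- The oracles may depend on the environment, so that a string coded by a variable can serve as an
-- oracle. The query is put in front of the environment.
record ComputableOracles {n k} (γ : Vec ℕ n → Vec (ℕ → ℕ) k) : Set where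
  constructor mkComputableOracles
  field oracles : ∀ j → Computable (λ ρ → lookup (γ (tail ρ)) j (head ρ))
open ComputableOracles

apply-computable : {γ : Vec ℕ n → Vec (ℕ → ℕ) k} {I : Vec ℕ n → ℕ} →
  ComputableOracles γ → ∀ j → Computable I → Computable (λ ρ → lookup (γ ρ) j (I ρ))
apply-computable o j i = comp-computable (oracles o j) (cons-computable* i id-computable*)

weaken-oracles : {γ : Vec ℕ n → Vec (ℕ → ℕ) k} → ComputableOracles γ →
  ComputableOracles (λ ρ → γ (tail ρ))
weaken-oracles o = mkComputableOracles λ j →
  comp-computable (oracles o j) (cons-computable* var₀ (weaken* (weaken* id-computable*)))

head-computable : {Xs : Vec ℕ n → Vec ℕ (suc m)} → Computable* Xs → Computable (λ ρ → head (Xs ρ))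
head-computable {Xs = Xs} q = ≗-computable (λ ρ → lookup-zero (Xs ρ)) (component q zero)

mutual
  -- Recursion on the fixed code `c`, following the clauses of `eval`. Convergence within time `s`
  -- to a given value thereby becomes a recursive relation.
  eval-computable : (c : μRec k n) {S : Vec ℕ m → ℕ} {γ : Vec ℕ m → Vec (ℕ → ℕ) k}
    {Xs : Vec ℕ m → Vec ℕ n} → Computable S → ComputableOracles γ → Computable* Xs →
    Computable (λ ρ → eval c (S ρ) (γ ρ) (Xs ρ))
  eval-computable zer         s o q = const-computable 1
  eval-computable succ        s o q = suc-computable (suc-computable (head-computable q))
  eval-computable (proj i)    s o q = suc-computable (component q i)
  eval-computable (oracle i)  s o q =
    ifz-computable (∸-computable (suc-computable (head-computable q)) s)
      (suc-computable (apply-computable o i (head-computable q))) (const-computable 0)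
  eval-computable (comp c ds) {S} {γ} {Xs} s o q =
    guards-computable (eval*-computable ds s o q) (eval-computable c s o (mkComputable* λ j →
      ≗-computable (λ ρ → sym (lookup-map j pred (eval* ds (S ρ) (γ ρ) (Xs ρ))))
        (pred-computable (component (eval*-computable ds s o q) j))))
  eval-computable (prec c d)  s o q =
    natrec-computable (eval-computable c s o (tail-computable* q))
      (ifz-computable var₁ (const-computable 0)
        (eval-computable d (weaken (weaken s)) (weaken-oracles (weaken-oracles o))
          (cons-computable* var₀ (cons-computable* (pred-computable var₁)
            (weaken* (weaken* (tail-computable* q)))))))
      (head-computable q)
  eval-computable (μ c)       s o q =
    pred-computable (natrec-computable (const-computable 0)
      (ifz-computable var₁
        (ifz-computable v (const-computable 1)
          (ifz-computable (pred-computable v) (suc-computable (suc-computable var₀)) (const-computable 0)))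
        var₁) s)
    where
    v = eval-computable c (weaken (weaken s)) (weaken-oracles (weaken-oracles o))
          (cons-computable* var₀ (weaken* (weaken* q)))

  eval*-computable : ∀ {p} (ds : Vec (μRec k n) p) {S : Vec ℕ m → ℕ} {γ : Vec ℕ m → Vec (ℕ → ℕ) k}
    {Xs : Vec ℕ m → Vec ℕ n} → Computable S → ComputableOracles γ → Computable* Xs →
    Computable* (λ ρ → eval* ds (S ρ) (γ ρ) (Xs ρ))
  eval*-computable []       s o q = mkComputable* λ ()
  eval*-computable (d ∷ ds) s o q = cons-computable* (eval-computable d s o q) (eval*-computable ds s o q)

-- Ternary strings

-- The successor modulo 3 on the residues.
cycle : ℕ → ℕ
cycle r = ifz r 1 (ifz (pred r) 2 0)

mod3 : ℕ → ℕ
mod3 = natrec 0 (λ _ r → cycle r)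

-- The quotient grows exactly when the residue passes from 2 to 0, which is when `mod3 i ∸ 1` is
-- nonzero.
div3 : ℕ → ℕ
div3 = natrec 0 (λ i r → ifz (mod3 i ∸ 1) r (suc r))

-- Digits in base 3, the lowest first. A string of length `s` is a number below `3^ s`, and `digit`
-- continues it by zeros to a total oracle.
digit : ℕ → ℕ → ℕ
digit w i = mod3 (natrec w (λ _ → div3) i)

mod3<3 : ∀ w → mod3 w < 3
mod3<3 zero    = s≤s z≤n
mod3<3 (suc w) = lemma (mod3 w)
  where
  lemma : ∀ r → cycle r < 3
  lemma 0             = s≤s (s≤s z≤n)
  lemma 1             = s≤s (s≤s (s≤s z≤n))
  lemma (suc (suc r)) = s≤s z≤n

digit<3 : ∀ w i → digit w i < 3
digit<3 w i = mod3<3 (natrec w (λ _ → div3) i)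

mod3-3+ : ∀ w → mod3 (3 + w) ≡ mod3 w
mod3-3+ w with mod3 w | mod3<3 w
... | 0 | _ = refl
... | 1 | _ = refl
... | 2 | _ = refl
... | suc (suc (suc _)) | s≤s (s≤s (s≤s ()))

div3-3+ : ∀ w → div3 (3 + w) ≡ suc (div3 w)
div3-3+ w with mod3 w | mod3<3 w
... | 0 | _ = refl
... | 1 | _ = refl
... | 2 | _ = refl
... | suc (suc (suc _)) | s≤s (s≤s (s≤s ()))

mod3-*3+ : ∀ q {v} → v < 3 → mod3 (q * 3 + v) ≡ v
mod3-*3+ zero {0} _ = refl
mod3-*3+ zero {1} _ = refl
mod3-*3+ zero {2} _ = refl
mod3-*3+ zero {suc (suc (suc _))} (s≤s (s≤s (s≤s ())))
mod3-*3+ (suc q) v<3 = trans (mod3-3+ (q * 3 + _)) (mod3-*3+ q v<3)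

div3-*3+ : ∀ q {v} → v < 3 → div3 (q * 3 + v) ≡ q
div3-*3+ zero {0} _ = refl
div3-*3+ zero {1} _ = refl
div3-*3+ zero {2} _ = refl
div3-*3+ zero {suc (suc (suc _))} (s≤s (s≤s (s≤s ())))
div3-*3+ (suc q) v<3 = trans (div3-3+ (q * 3 + _)) (cong suc (div3-*3+ q v<3))

digit-suc : ∀ w i → digit w (suc i) ≡ digit (div3 w) i
digit-suc w i = cong mod3 (lemma i)
  where
  lemma : ∀ i → natrec w (λ _ → div3) (suc i) ≡ natrec (div3 w) (λ _ → div3) i
  lemma zero    = refl
  lemma (suc i) = cong div3 (lemma i)

number : (ℕ → ℕ) → ℕ → ℕ
number g zero    = 0
number g (suc n) = number (g ∘ suc) n * 3 + g 0

3^_ : ℕ → ℕ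
3^_ = natrec 1 (λ _ r → r + (r + r))

number<3^ : ∀ g n → (∀ i → g i < 3) → number g n < 3^ n
number<3^ g zero    g<3 = s≤s z≤n
number<3^ g (suc n) g<3 = begin-strict
  q * 3 + g 0            <⟨ +-monoʳ-< (q * 3) (g<3 0) ⟩
  q * 3 + 3              ≡⟨ +-comm (q * 3) 3 ⟩
  suc q * 3              ≤⟨ *-monoˡ-≤ 3 (number<3^ (g ∘ suc) n (g<3 ∘ suc)) ⟩
  3^ n * 3               ≡⟨ *-comm (3^ n) 3 ⟩
  3 * 3^ n               ≡⟨ cong (λ r → 3^ n + (3^ n + r)) (+-identityʳ (3^ n)) ⟩
  3^ n + (3^ n + 3^ n)   ∎
  where
  open ≤-Reasoning
  q = number (g ∘ suc) n

digit-number : ∀ g n → (∀ i → g i < 3) → ∀ i → i < n → digit (number g n) i ≡ g i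
digit-number g (suc n) g<3 zero    _         = mod3-*3+ (number (g ∘ suc) n) (g<3 0)
digit-number g (suc n) g<3 (suc i) (s≤s i<n) =
  trans (digit-suc (number g (suc n)) i)
    (trans (cong (λ w → digit w i) (div3-*3+ (number (g ∘ suc) n) (g<3 0)))
      (digit-number (g ∘ suc) n (g<3 ∘ suc) i i<n))

3^-computable : {F : Vec ℕ n → ℕ} → Computable F → Computable (λ ρ → 3^ (F ρ))
3^-computable f = natrec-computable (const-computable 1)
  (+-computable var₁ (+-computable var₁ var₁)) f

mod3-computable : {F : Vec ℕ n → ℕ} → Computable F → Computable (λ ρ → mod3 (F ρ))
mod3-computable f = natrec-computable (const-computable 0)
  (ifz-computable var₁ (const-computable 1)
    (ifz-computable (pred-computable var₁) (const-computable 2) (const-computable 0))) f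

div3-computable : {F : Vec ℕ n → ℕ} → Computable F → Computable (λ ρ → div3 (F ρ))
div3-computable f = natrec-computable (const-computable 0)
  (ifz-computable (∸-computable (mod3-computable var₀) (const-computable 1))
    var₁ (suc-computable var₁)) f

digit-computable : {F G : Vec ℕ n → ℕ} → Computable F → Computable G →
  Computable (λ ρ → digit (F ρ) (G ρ))
digit-computable f g = mod3-computable (natrec-computable f (div3-computable var₁) g)

-- The least number other than `a` and `b`. It is at most 2, so two exclusions always leave one of
-- three values.
third : ℕ → ℕ → ℕ
third 0 0 = 1
third 0 1 = 2
third 0 _ = 1
third 1 0 = 2
third 1 _ = 0
third _ 0 = 1
third _ _ = 0

third<3 : ∀ a b → third a b < 3
third<3 0 0 = s≤s (s≤s z≤n)
third<3 0 1 = s≤s (s≤s (s≤s z≤n))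
third<3 0 (suc (suc _)) = s≤s (s≤s z≤n)
third<3 1 0 = s≤s (s≤s (s≤s z≤n))
third<3 1 (suc _) = s≤s z≤n
third<3 (suc (suc _)) 0 = s≤s (s≤s z≤n)
third<3 (suc (suc _)) (suc _) = s≤s z≤n

third≢ˡ : ∀ a b → third a b ≢ a
third≢ˡ 0 0 ()
third≢ˡ 0 1 ()
third≢ˡ 0 (suc (suc _)) ()
third≢ˡ 1 0 ()
third≢ˡ 1 (suc _) ()
third≢ˡ (suc (suc _)) 0 ()
third≢ˡ (suc (suc _)) (suc _) ()

third≢ʳ : ∀ a b → third a b ≢ b
third≢ʳ 0 0 ()
third≢ʳ 0 1 ()
third≢ʳ 0 (suc (suc _)) ()
third≢ʳ 1 0 ()
third≢ʳ 1 (suc _) ()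
third≢ʳ (suc (suc _)) 0 ()
third≢ʳ (suc (suc _)) (suc _) ()

-- Functions spliced at a place

patch : (ℕ → ℕ) → ℕ → (ℕ → ℕ) → ℕ → ℕ
patch g zero    h i       = h i
patch g (suc m) h zero    = g 0
patch g (suc m) h (suc i) = patch (g ∘ suc) m (h ∘ suc) i

patch-< : ∀ g m h i → i < m → patch g m h i ≡ g i
patch-< g (suc m) h zero    i<m       = refl
patch-< g (suc m) h (suc i) (s≤s i<m) = patch-< (g ∘ suc) m (h ∘ suc) i i<m

patch-≥ : ∀ g m h i → m ≤ i → patch g m h i ≡ h i
patch-≥ g zero    h i       m≤i       = refl
patch-≥ g (suc m) h (suc i) (s≤s m≤i) = patch-≥ (g ∘ suc) m (h ∘ suc) i m≤i

patch-either : ∀ g m h i → patch g m h i ≡ g i ⊎ patch g m h i ≡ h i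
patch-either g zero    h i       = inj₂ refl
patch-either g (suc m) h zero    = inj₁ refl
patch-either g (suc m) h (suc i) = patch-either (g ∘ suc) m (h ∘ suc) i

patch-cong : ∀ g m {h h′} {s} → (∀ i → i < s → h i ≡ h′ i) → ∀ i → i < s →
  patch g m h i ≡ patch g m h′ i
patch-cong g zero    e i       i<s = e i i<s
patch-cong g (suc m) e zero    i<s = refl
patch-cong g (suc m) {s = suc s} e (suc i) (s≤s i<s) =
  patch-cong (g ∘ suc) m (λ i i<s → e (suc i) (s≤s i<s)) i i<s

-- Only the first `m` values of `g` enter, as constants of the code; `g` itself may be
-- noncomputable.
patch-computable : ∀ g m {H : Vec ℕ n → ℕ → ℕ} →
  (∀ {I} → Computable I → Computable (λ ρ → H ρ (I ρ))) →
  {I : Vec ℕ n → ℕ} → Computable I → Computable (λ ρ → patch g m (H ρ) (I ρ))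
patch-computable g zero    h i = h i
patch-computable {n} g (suc m) {H} h {I} i = ≗-computable (λ ρ → lemma (H ρ) (I ρ))
  (ifz-computable i (const-computable (g 0))
    (patch-computable (g ∘ suc) m {λ ρ i → H ρ (suc i)} (λ i → h (suc-computable i))
      (pred-computable i)))
  where
  lemma : ∀ h i → ifz i (g 0) (patch (g ∘ suc) m (h ∘ suc) (pred i)) ≡ patch g (suc m) h i
  lemma h zero    = refl
  lemma h (suc i) = refl

-- Compactness of 3^ℕ

Unbounded : (ℕ → Set) → Set
Unbounded P = ∀ m → ∃[ s ] (m ≤ s × P s)

module _ (em : ExcludedMiddle 0ℓ) where

  em-stable : {P : Set} → ¬ ¬ P → P
  em-stable = decidable-stable em

  -- If each value below `k` were taken only boundedly often on `P`, then `bound` would give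
  -- `k ≤ h s` for all large `s` in `P`.
  pigeonhole : {P : ℕ → Set} (h : ℕ → ℕ) → ∀ k → (∀ s → h s < k) → Unbounded P →
    ∃[ v ] Unbounded (λ s → P s × h s ≡ v)
  pigeonhole {P} h k h<k P∞ = em-stable λ none → let
      m , above       = bound none k
      s , m≤s , Ps    = P∞ m
    in <⇒≱ (h<k s) (above s m≤s Ps)
    where
    bound : ¬ (∃[ v ] Unbounded (λ s → P s × h s ≡ v)) → ∀ k → ∃[ m ] (∀ s → m ≤ s → P s → k ≤ h s)
    bound none zero    = 0 , λ _ _ _ → z≤n
    bound none (suc k) with bound none k
    ... | m , above = em-stable λ ¬bound → none (k , λ m′ → em-stable λ ¬s →
      ¬bound (m ⊔ m′ , λ s le Ps → ≤∧≢⇒< (above s (≤-trans (m≤m⊔n m m′) le) Ps)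
        λ k≡ → ¬s (s , ≤-trans (m≤n⊔m m m′) le , Ps , sym k≡)))

  -- Stage `n` is an unbounded set of indices `s` on which the first `n` values of `g s` are
  -- constant; the pigeonhole principle thins it out to the next stage.
  cluster-point : (g : ℕ → ℕ → ℕ) → ∀ k → (∀ s i → g s i < k) →
    ∃[ f ] (∀ n → Unbounded (λ s → ∀ i → i < n → g s i ≡ f i))
  cluster-point g k g<k = f , λ n m → let s , m≤s , Ps = proj₂ (stage n) m in
      s , m≤s , agree n s Ps
    where
    next : ∀ n → ∃ Unbounded → ∃ Unbounded
    next n (P , P∞) = _ , proj₂ (pigeonhole (λ s → g s n) k (λ s → g<k s n) P∞)

    stage : ℕ → ∃ Unbounded
    stage zero    = (λ _ → ⊤) , λ m → m , ≤-refl , tt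
    stage (suc n) = next n (stage n)

    f : ℕ → ℕ
    f n = proj₁ (pigeonhole (λ s → g s n) k (λ s → g<k s n) (proj₂ (stage n)))

    agree : ∀ n s → proj₁ (stage n) s → ∀ i → i < n → g s i ≡ f i
    agree (suc n) s (Ps , e) i i<1+n with m<1+n⇒m<n∨m≡n i<1+n
    ... | inj₁ i<n  = agree n s Ps i i<n
    ... | inj₂ refl = e

  -- Baire category for learners

  ↾-cong : ∀ {g h} n → (∀ i → i < n → g i ≡ h i) → g ↾ n ≡ h ↾ n
  ↾-cong zero    e = refl
  ↾-cong (suc n) e = cong₂ _∷_ (e 0 (s≤s z≤n)) (↾-cong n λ i i<n → e (suc i) (s≤s i<n))

  -- Baire category: D is closed, so if Ψ changed its mind in every cylinder of
  -- D, it would change its mind infinitely often on some element of D.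
  locally-constant : (Ψ : List ℕ → ℕ) (D : Pred (ℕ → ℕ) 0ℓ) →
    (∀ {f} → (∀ i → ∃[ g ] (g ∈ D × f i ≡ g i)) → f ∈ D) →
    (∀ {g} → g ∈ D → ∃[ l ] Limit (λ n → Ψ (g ↾ n)) l) →
    ∀ {g₀} → g₀ ∈ D →
    ∃[ g ] ∃[ N ] (g ∈ D × (∀ {g′} → g′ ∈ D → (∀ i → i < N → g i ≡ g′ i) →
      ∀ n → N ≤ n → Ψ (g′ ↾ n) ≡ Ψ (g ↾ N)))
  locally-constant Ψ D local converges {g₀} g₀∈ = em-stable λ none → refute λ g N g∈ →
    em-stable λ ¬change → none (g , N , g∈ , λ {g′} g′∈ agree n N≤n →
      em-stable λ ≢ → ¬change (g′ , n , g′∈ , agree , N≤n , ≢))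
    where
    refute : ¬ (∀ g N → g ∈ D → ∃[ g′ ] ∃[ n ] (g′ ∈ D × (∀ i → i < N → g i ≡ g′ i) ×
      N ≤ n × Ψ (g′ ↾ n) ≢ Ψ (g ↾ N)))
    refute change = contradict (converges f∈D)
      where
      stage : ℕ → ∃[ g ] (ℕ × g ∈ D)
      stage zero    = g₀ , 0 , g₀∈
      stage (suc i) = let g , N , g∈ = stage i ; g′ , n , g′∈ , _ = change g N g∈ in g′ , n , g′∈

      G : ℕ → ℕ → ℕ
      G i = proj₁ (stage i)

      N : ℕ → ℕ
      N i = proj₁ (proj₂ (stage i))

      step : ∀ i → (∀ j → j < N i → G i j ≡ G (suc i) j) × N i ≤ N (suc i) ×
        Ψ (G (suc i) ↾ N (suc i)) ≢ Ψ (G i ↾ N i)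
      step i = proj₂ (proj₂ (proj₂ (change (G i) (N i) (proj₂ (proj₂ (stage i))))))

      -- At equal lengths the two strings would coincide, and the learner could not have changed its
      -- mind.
      N-increasing : ∀ i → N i < N (suc i)
      N-increasing i with step i
      ... | agree , N≤ , ≢ = ≤∧≢⇒< N≤ λ N≡ → ≢ (cong Ψ (trans
        (cong (G (suc i) ↾_) (sym N≡)) (sym (↾-cong (N i) agree))))

      i≤N : ∀ i → i ≤ N i
      i≤N zero    = z≤n
      i≤N (suc i) = ≤-trans (s≤s (i≤N i)) (N-increasing i)

      G-agree : ∀ i d j → j < N i → G i j ≡ G (d + i) j × j < N (d + i)
      G-agree i zero    j j<N = refl , j<N
      G-agree i (suc d) j j<N with G-agree i d j j<N
      ... | e , j<N′ = trans e (proj₁ (step (d + i)) j j<N′) , <-trans j<N′ (N-increasing (d + i))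

      -- Place `j` is settled from stage `suc j` on, because `j < N (suc j)`.
      f : ℕ → ℕ
      f j = G (suc j) j

      f∈D : f ∈ D
      f∈D = local λ j → G (suc j) , proj₂ (proj₂ (stage (suc j))) , refl

      f≡G : ∀ i j → j < N i → f j ≡ G i j
      f≡G i j j<N with G-agree (suc j) i j (i≤N (suc j)) | G-agree i (suc j) j j<N
      ... | e , _ | e′ , _ = trans e (trans (cong (λ t → G t j) (+-comm i (suc j))) (sym e′))

      Ψf : ∀ i → Ψ (f ↾ N i) ≡ Ψ (G i ↾ N i)
      Ψf i = cong Ψ (↾-cong (N i) (f≡G i))

      contradict : ¬ (∃[ l ] Limit (λ n → Ψ (f ↾ n)) l)
      contradict (l , M , lim) =
        -- The stages `M` and `suc M` both lie beyond the modulus `M`, since `i ≤ N i`, yet the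
        -- learner differs on them.
        proj₂ (proj₂ (step M)) (trans (limit (suc M) (n≤1+n M)) (sym (limit M ≤-refl)))
        where
        limit : ∀ i → M ≤ i → Ψ (G i ↾ N i) ≡ l
        limit i M≤i = trans (sym (Ψf i)) (lim (N i) (≤-trans M≤i (i≤N i)))

-- Diagonally noncomputable functions and unavoidable colours

module _ (em : ExcludedMiddle 0ℓ) (φ : ℕ → ℕₛ ⇀ ℕₛ) (φ-enum : IsEffectiveEnumeration φ) where
  open IsEffectiveEnumeration φ-enum

  -- Membership restricts each value separately, so `DNR φ k` is a product of sets of values. Hence
  -- it is closed, and closed under splicing.
  DNR-local : ∀ {k f} → (∀ i → ∃[ g ] (g ∈ DNR φ k × f i ≡ g i)) → f ∈ DNR φ k
  DNR-local {k} near =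
    (λ i → let _ , (g<k , _) , f≡g = near i in subst (_< k) (sym f≡g) (g<k i)) ,
    (λ e y φe f≡y → let _ , (_ , g≢) , f≡g = near e in g≢ e y φe (trans (sym f≡g) f≡y))

  patch∈DNR : ∀ {k g h} m → g ∈ DNR φ k → h ∈ DNR φ k → patch g m h ∈ DNR φ k
  patch∈DNR {k} {g} {h} m g∈ h∈ = DNR-local near
    where
    near : ∀ i → ∃[ f ] (f ∈ DNR φ k × patch g m h i ≡ f i)
    near i with patch-either g m h i
    ... | inj₁ e = g , g∈ , e
    ... | inj₂ e = h , h∈ , e

  -- The diagonal value of `φ` at `i` if this lies below 3, and 0 otherwise. A ternary function
  -- cannot take a larger value anyway.
  diagonal : ∀ i → ∃[ a ] (a < 3 × (∀ y → y < 3 → graph (φ i) i y → y ≡ a))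
  diagonal i with em {∃[ y ] (y < 3 × graph (φ i) i y)}
  ... | yes (a , a<3 , φa) = a , a<3 , λ y _ φy → functional (φ i) φy φa
  ... | no ¬φ = 0 , s≤s z≤n , λ y y<3 φy → ⊥-elim (¬φ (y , y<3 , φy))

  forbidden : ℕ → ℕ
  forbidden i = proj₁ (diagonal i)

  forbidden<3 : ∀ i → forbidden i < 3
  forbidden<3 i = proj₁ (proj₂ (diagonal i))

  avoiding∈DNR₃ : ∀ {f} → (∀ i → f i < 3) → (∀ i → f i ≢ forbidden i) → f ∈ DNR φ 3
  avoiding∈DNR₃ f<3 f≢ = f<3 , λ e y φe f≡y → f≢ e
    (trans f≡y (proj₂ (proj₂ (diagonal e)) y (subst (_< 3) f≡y (f<3 e)) φe))

  -- A fixed element of `DNR φ 3`, used as a starting point and as the tail of survivors.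
  escape : ℕ → ℕ
  escape i = third (forbidden i) (forbidden i)

  escape∈DNR₃ : escape ∈ DNR φ 3
  escape∈DNR₃ = avoiding∈DNR₃ (λ i → third<3 (forbidden i) (forbidden i))
    (λ i → third≢ˡ (forbidden i) (forbidden i))

  -- A s c x g is meant as "within time s, the oracle g is seen to give x the colour c".
  module Colouring
    (A : ℕ → ℕ → ℕ → (ℕ → ℕ) → Set)
    (A-mono : ∀ {s t c x g h} → s ≤ t → (∀ i → i < s → g i ≡ h i) → A s c x g → A t c x h)
    (A-recursive : ∀ c {n} {S X W : Vec ℕ n → ℕ} → Computable S → Computable X → Computable W →
      Recursive (λ ρ → A (S ρ) c (X ρ) (digit (W ρ))))
    where

    u : μRec 0 2
    u = proj₁ universal

    -- The diagonal of `φ` enters only as far as it is seen within time `s`, which keeps the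
    -- condition recursive.
    Compatible : ℕ → ℕ → Set
    Compatible s a = ∀ i → i < s → ∀ y → y < 3 → eval u s [] (i ∷ i ∷ []) ≡ suc y → y ≡ digit a i

    -- However one value at each place is forbidden, as long as the values
    -- already computed by the diagonal of φ are, a string of colour c survives.
    Unavoidable : ℕ → ℕ → ℕ → Set
    Unavoidable s c x = ∀ a → a < 3^ s → Compatible s a →
      ∃[ v ] (v < 3^ s × ((∀ i → i < s → digit v i ≢ digit a i) × A s c x (digit v)))

    Compatible-recursive : ∀ {n} {S W : Vec ℕ n → ℕ} → Computable S → Computable W →
      Recursive (λ ρ → Compatible (S ρ) (W ρ))
    Compatible-recursive s w = ∀<-recursive s (∀<-recursive (const-computable 3)
      (→-recursive
        (≡-recursive
          (eval-computable u (weaken (weaken s)) (mkComputableOracles λ ())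
            (cons-computable* var₁ (cons-computable* var₁ (mkComputable* λ ()))))
          (suc-computable var₀))
        (≡-recursive var₀ (digit-computable (weaken (weaken w)) var₁))))

    -- Every quantifier is bounded, as strings of length `s` are numbers below `3^ s`.
    Unavoidable-recursive : ∀ c → Recursive {2} (λ ρ → Unavoidable (head ρ) c (head (tail ρ)))
    Unavoidable-recursive c = ∀<-recursive (3^-computable var₀)
      (→-recursive (Compatible-recursive var₁ var₀)
        (∃<-recursive (3^-computable var₁)
          (×-recursive
            (∀<-recursive (weaken var₁)
              (¬-recursive (≡-recursive (digit-computable var₁ var₀)
                                        (digit-computable (weaken var₁) var₀))))
            (A-recursive c (weaken var₁) (weaken (weaken var₁)) var₀))))

    avoider : ∀ {s c x} → ¬ Unavoidable s c x →
      ∃[ a ] (Compatible s a ×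
        (∀ v → v < 3^ s → (∀ i → i < s → digit v i ≢ digit a i) → ¬ A s c x (digit v)))
    avoider ¬u = em-stable em λ no → ¬u λ a a<3^s comp → em-stable em λ ¬v →
      no (a , comp , λ v v<3^s avoids Av → ¬v (v , v<3^s , avoids , Av))

    -- A violation by `f` would involve only finitely many values and a finite time, so it would
    -- already show at a late `g s` that agrees with `f` there.
    cluster-point-uncoloured : ∀ {x} (g : ℕ → ℕ → ℕ) → (∀ s i → g s i < 3) →
      (∀ s i → i < s → eval u s [] (i ∷ i ∷ []) ≢ suc (g s i)) →
      (∀ s → ¬ (A s 0 x (g s) ⊎ A s 1 x (g s))) →
      ∀ f → (∀ n → Unbounded (λ s → ∀ i → i < n → g s i ≡ f i)) →
      f ∈ DNR φ 3 × (∀ s → ¬ (A s 0 x f ⊎ A s 1 x f))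
    cluster-point-uncoloured {x} g g<3 g≢ uncoloured f cluster = (f<3 , f≢) , f-uncoloured
      where
      f<3 : ∀ i → f i < 3
      f<3 i with cluster (suc i) 0
      ... | s , _ , g≈f = subst (_< 3) (g≈f i ≤-refl) (g<3 s i)

      f≢ : ∀ e y → graph (φ e) e y → f e ≢ y
      f≢ e y φe fe≡y with eval-complete u (e ∷ e ∷ []) (to (proj₂ universal e e y) φe)
      -- The stage must exceed both the convergence time `t` and the place `e`.
      ... | t , conv with cluster (suc e) (t ⊔ suc e)
      ... | s , le , g≈f = g≢ s e (≤-trans (m≤n⊔m t (suc e)) le)
        (trans (eval-later u (≤-trans (m≤m⊔n t (suc e)) le) conv)
          (cong suc (sym (trans (g≈f e ≤-refl) fe≡y))))

      f-uncoloured : ∀ s → ¬ (A s 0 x f ⊎ A s 1 x f)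
      f-uncoloured s As with cluster s s
      ... | t , s≤t , g≈f = uncoloured t (Sum.map later later As)
        where
        later : ∀ {c} → A s c x f → A t c x (g t)
        later = A-mono s≤t (λ i i<s → sym (g≈f i i<s))

    -- Each colour is avoided by some forbidden string, `a` or `b`. The third values differ from
    -- `a`, hence from the visible diagonal, and from `b`, so they miss both colours.
    common-avoider : ∀ {s x} → ¬ (Unavoidable s 0 x ⊎ Unavoidable s 1 x) →
      ∃[ v ] ((∀ i → i < s → eval u s [] (i ∷ i ∷ []) ≢ suc (digit v i)) ×
        ¬ (A s 0 x (digit v) ⊎ A s 1 x (digit v)))
    common-avoider {s} {x} none
      with avoider (none ∘ inj₁) | avoider (none ∘ inj₂)
    ... | a , a-compatible , avoids₀ | b , _ , avoids₁ = v ,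
      (λ i i<s e → v≢a i i<s (a-compatible i i<s (digit v i) (digit<3 v i) e)) ,
      λ { (inj₁ Av) → avoids₀ v v<3^s v≢a Av ; (inj₂ Av) → avoids₁ v v<3^s v≢b Av }
      where
      other : ℕ → ℕ
      other i = third (digit a i) (digit b i)

      other<3 : ∀ i → other i < 3
      other<3 i = third<3 (digit a i) (digit b i)

      v : ℕ
      v = number other s

      v<3^s : v < 3^ s
      v<3^s = number<3^ other s other<3

      v≢a : ∀ i → i < s → digit v i ≢ digit a i
      v≢a i i<s e = third≢ˡ (digit a i) (digit b i)
        (trans (sym (digit-number other s other<3 i i<s)) e)

      v≢b : ∀ i → i < s → digit v i ≢ digit b i
      v≢b i i<s e = third≢ʳ (digit a i) (digit b i)
        (trans (sym (digit-number other s other<3 i i<s)) e)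

    -- Otherwise there is an uncoloured string for every `s`, and by compactness these cluster at an
    -- uncoloured element of `DNR φ 3`.
    unavoidable-colour : ∀ x → (∀ g → g ∈ DNR φ 3 → ∃[ s ] (A s 0 x g ⊎ A s 1 x g)) →
      ∃[ s ] (Unavoidable s 0 x ⊎ Unavoidable s 1 x)
    unavoidable-colour x coloured = em-stable em λ none → refute λ s →
      common-avoider λ unavoidable → none (s , unavoidable)
      where
      refute : ¬ (∀ s → ∃[ v ] ((∀ i → i < s → eval u s [] (i ∷ i ∷ []) ≢ suc (digit v i)) ×
        ¬ (A s 0 x (digit v) ⊎ A s 1 x (digit v))))
      refute avoid = let
          g s     = digit (proj₁ (avoid s))
          f , cl  = cluster-point em g 3 (λ s → digit<3 (proj₁ (avoid s)))
          f∈ , ¬c = cluster-point-uncoloured g (λ s → digit<3 (proj₁ (avoid s)))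
                      (λ s → proj₁ (proj₂ (avoid s))) (λ s → proj₂ (proj₂ (avoid s))) f cl
          s , c   = coloured f f∈
        in ¬c s c

    -- The true forbidden values form a compatible string, so some string of colour `c` avoids them;
    -- `escape` continues it within `DNR φ 3`.
    survivor : ∀ {s c x} → Unavoidable s c x → ∃[ g ] (g ∈ DNR φ 3 × A s c x g)
    survivor {s} {c} {x} unav
      with unav (number forbidden s) (number<3^ forbidden s forbidden<3) compatible
      where
      compatible : Compatible s (number forbidden s)
      compatible i i<s y y<3 e = trans
        (proj₂ (proj₂ (diagonal i)) y y<3 (from (proj₂ universal i i y) (eval-sound u _ e)))
        (sym (digit-number forbidden s forbidden<3 i i<s))
    ... | v , _ , v≢ , Av = g ,
      avoiding∈DNR₃ g<3 g≢ , A-mono ≤-refl (λ i i<s → sym (patch-< (digit v) s escape i i<s)) Av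
      where
      g : ℕ → ℕ
      g = patch (digit v) s escape

      g<3 : ∀ i → g i < 3
      g<3 i with patch-either (digit v) s escape i
      ... | inj₁ e = subst (_< 3) (sym e) (digit<3 v i)
      ... | inj₂ e = subst (_< 3) (sym e) (proj₁ escape∈DNR₃ i)

      g≢ : ∀ i → g i ≢ forbidden i
      g≢ i e with i <? s
      ... | yes i<s = v≢ i i<s (trans (sym (patch-< (digit v) s escape i i<s))
                        (trans e (sym (digit-number forbidden s forbidden<3 i i<s))))
      ... | no i≮s = third≢ˡ (forbidden i) (forbidden i)
                       (trans (sym (patch-≥ (digit v) s escape i (≮⇒≥ i≮s))) e)

    φ-colour : (∀ x g → g ∈ DNR φ 3 → ∃[ s ] (A s 0 x g ⊎ A s 1 x g)) →
      ∃[ x ] ∃[ c ] (graph (φ x) x c × ∃[ s ] ∃[ g ] (g ∈ DNR φ 3 × A s c x g))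
    φ-colour coloured with select Unavoidable-recursive
    ... | d , selects with complete ψ (d , λ x y → mk⇔ id id)
      where
      ψ : ℕₛ ⇀ ℕₛ
      ψ = record
        { graph      = λ x y → ⟦ d ⟧ [] (x ∷ []) y
        ; respˡ      = λ { refl p → p }
        ; respʳ      = λ { refl p → p }
        ; functional = ⟦⟧-functional d
        }
    -- The input is the index of `ψ` itself, which makes the colour `c` the diagonal value of `φ` at
    -- `x`.
    ... | x , φx≐ψ with selects x (unavoidable-colour x (coloured x))
    ... | c , dc , s , unav = x , c , from (φx≐ψ x c) dc , s , survivor unav

  -- Finite families of functionals on a cylinder

  module _ (Φ : ℕ → 𝓝 ⇀ 𝓝) (Φ-enum : IsEffectiveEnumeration𝓝 Φ) where
    private
      U : μRec 1 2
      U = proj₁ (IsEffectiveEnumeration𝓝.universal Φ-enum)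

      U-universal : ∀ {e g h} → graph (Φ e) g h → ∀ n → ⟦ U ⟧ (g ∷ []) (e ∷ n ∷ []) (h n)
      U-universal {e} {g} {h} = to (proj₂ (IsEffectiveEnumeration𝓝.universal Φ-enum) e g h)

    Reduces : List ℕ → Pred (ℕ → ℕ) 0ℓ
    Reduces es g = ∃[ e ] ∃[ h ] (e ∈ˡ es × graph (Φ e) g h × h ∈ DNR φ 2)

    -- Induction on the bound `l` for the number of indices: each round passes to a smaller cylinder
    -- and discards an index that can no longer yield an element of `DNR φ 2` there.
    ¬finitely-reduces : ∀ es l → length es ≤ l → ∀ {g₀} → g₀ ∈ DNR φ 3 → ∀ m →
      ¬ (∀ {g} → g ∈ DNR φ 3 → (∀ i → i < m → g₀ i ≡ g i) → Reduces es g)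
    ¬finitely-reduces es zero le g₀∈ m reduces with es | reduces g₀∈ (λ _ _ → refl)
    ¬finitely-reduces es zero () g₀∈ m reduces | _ ∷ _ | _
    ... | [] | _ , _ , () , _
    ¬finitely-reduces es (suc l) le {g₀} g₀∈ m reduces = spend (φ-colour coloured)
      where
      A : ℕ → ℕ → ℕ → (ℕ → ℕ) → Set
      -- Overwriting the first `m` values by those of `g₀` moves any oracle into the given cylinder.
      A s c x g = Any (λ e → eval U s (patch g₀ m g ∷ []) (e ∷ x ∷ []) ≡ suc c) es

      A-mono : ∀ {s t c x g h} → s ≤ t → (∀ i → i < s → g i ≡ h i) → A s c x g → A t c x h
      A-mono s≤t g≈h = Any.map (eval-mono s≤t (λ { zero → patch-cong g₀ m g≈h }) U _)

      A-recursive : ∀ c {n} {S X W : Vec ℕ n → ℕ} → Computable S → Computable X → Computable W →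
        Recursive (λ ρ → A (S ρ) c (X ρ) (digit (W ρ)))
      A-recursive c s x w = Any-recursive (λ e → ≡-recursive
        (eval-computable U s
          (mkComputableOracles λ { zero → patch-computable g₀ m (digit-computable (weaken w)) var₀ })
          (cons-computable* (const-computable e) (cons-computable* x (mkComputable* λ ()))))
        (const-computable (suc c))) es

      open Colouring A A-mono A-recursive

      coloured : ∀ x g → g ∈ DNR φ 3 → ∃[ s ] (A s 0 x g ⊎ A s 1 x g)
      coloured x g g∈
        with reduces (patch∈DNR m g₀∈ g∈) (λ i i<m → sym (patch-< g₀ m g i i<m))
      ... | e , h , e∈ , Φh , h<2 , _ with h x | h<2 x | eval-complete U _ (U-universal Φh x)
      ... | 0 | _ | s , conv = s , inj₁ (lose e∈ conv)
      ... | 1 | _ | s , conv = s , inj₂ (lose e∈ conv)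
      ... | suc (suc _) | s≤s (s≤s ()) | _

      spend : ¬ (∃[ x ] ∃[ c ] (graph (φ x) x c × ∃[ s ] ∃[ g ] (g ∈ DNR φ 3 × A s c x g)))
      spend (x , c , φx≡c , s , g , g∈ , As) =
        -- Length `m ⊔ s` keeps the new cylinder inside the old one and fixes every oracle value
        -- that the computation of `c` can use.
        ¬finitely-reduces es′ l shorter (patch∈DNR m g₀∈ g∈) (m ⊔ s) reduces′
        where
        e : ℕ
        e = proj₁ (find As)

        e∈ : e ∈ˡ es
        e∈ = proj₁ (proj₂ (find As))

        Φe : eval U s (patch g₀ m g ∷ []) (e ∷ x ∷ []) ≡ suc c
        Φe = proj₂ (proj₂ (find As))

        es′ : List ℕ
        es′ = filter (λ e′ → ¬? (e′ ≟ e)) es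

        shorter : length es′ ≤ l
        shorter = s≤s⁻¹ (≤-trans (filter-notAll _ es (lose e∈ (λ ≢e → ≢e refl))) le)

        -- By the use principle the computation with value `c` at `x` is the same throughout the new
        -- cylinder.
        hits-φ : ∀ {g′ h} → (∀ i → i < m ⊔ s → patch g₀ m g i ≡ g′ i) →
          graph (Φ e) g′ h → h x ≡ c
        hits-φ {g′} agree Φh = ⟦⟧-functional U (U-universal Φh x)
          (eval-sound U _ (eval-mono {δ = g′ ∷ []} ≤-refl
            (λ { zero i i<s → agree i (≤-trans i<s (m≤n⊔m m s)) }) U _ Φe))

        reduces′ : ∀ {g′} → g′ ∈ DNR φ 3 → (∀ i → i < m ⊔ s → patch g₀ m g i ≡ g′ i) →
          Reduces es′ g′
        reduces′ g′∈ agree = let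
            e′ , h , e′∈ , Φh , h∈ = reduces g′∈ λ i i<m →
              trans (sym (patch-< g₀ m g i i<m)) (agree i (≤-trans i<m (m≤m⊔n m s)))
          in e′ , h , ∈-filter⁺ (λ e′ → ¬? (e′ ≟ e)) e′∈
               -- If `e′` were `e`, then `h` would take the diagonal value `c` at `x`, which no
               -- element of `DNR φ 2` does.
               (λ e′≡e → proj₂ h∈ x c φx≡c
                 (hits-φ agree (subst (λ e → graph (Φ e) _ h) e′≡e Φh))) ,
             Φh , h∈

    ¬DNR₂≤DNR₃-<ω : ¬ (DNR φ 2 ≤[ ⟨<ω,1⟩-Computable Φ ] DNR φ 3)
    ¬DNR₂≤DNR₃-<ω (Γ , (b , bounded) , total , maps) =
      -- At length 0 the cylinder is all of `DNR φ 3`.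
      ¬finitely-reduces (upTo b) _ ≤-refl escape∈DNR₃ 0 λ g∈ _ → let
        h , Γh       = total g∈
        e , e<b , Φh = bounded Γh
      in e , h , ∈-upTo⁺ e<b , Φh , maps g∈ Γh

    -- On a cylinder where the learner is constant, its limit is one fixed index, so a one-element
    -- list of functionals would suffice there.
    ¬DNR₂≤DNR₃-ω : ¬ (DNR φ 2 ≤[ ⟨1,ω⟩-Computable Φ ] DNR φ 3)
    ¬DNR₂≤DNR₃-ω (Γ , (Ψ , _ , learns) , total , maps) =
      uniform (locally-constant em Ψ (DNR φ 3) DNR-local
        (λ g∈ → let _ , Γh = total g∈ ; e , lim , _ = learns Γh in e , lim) escape∈DNR₃)
      where
      uniform : ¬ (∃[ g ] ∃[ N ] (g ∈ DNR φ 3 ×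
        (∀ {g′} → g′ ∈ DNR φ 3 → (∀ i → i < N → g i ≡ g′ i) →
          ∀ n → N ≤ n → Ψ (g′ ↾ n) ≡ Ψ (g ↾ N))))
      uniform (g , N , g∈ , constant) =
        ¬finitely-reduces (Ψ (g ↾ N) ∷ []) _ ≤-refl g∈ N λ g′∈ agree → let
          h , Γh             = total g′∈
          e , (M , lim) , Φh = learns Γh
          e≡                 = trans (sym (lim (N ⊔ M) (m≤n⊔m N M)))
                                 (constant g′∈ agree (N ⊔ M) (m≤m⊔n N M))
        in e , h , here e≡ , Φh , maps g′∈ Γh

    -- The reductions by the identity

    DNR-mono : ∀ {k l} → k ≤ l → DNR φ k ⊆ DNR φ l
    DNR-mono k≤l (f<k , f≢) = (λ i → ≤-trans (f<k i) k≤l) , f≢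

    private
      identity : 𝓝 ⇀ 𝓝
      identity = record
        { graph      = λ g h → ∀ n → h n ≡ g n
        ; respˡ      = λ g≈ e n → trans (e n) (g≈ n)
        ; respʳ      = λ h≈ e n → trans (sym (h≈ n)) (e n)
        ; functional = λ e e′ n → trans (e n) (sym (e′ n))
        }

      identity-index : ∃[ e ] Φ e ≐ identity
      identity-index = IsEffectiveEnumeration𝓝.complete Φ-enum identity
        (oracle zero , λ g h → mk⇔ id id)

    DNR₃≤DNR₂ : (C : Pred (𝓝 ⇀ 𝓝) 0ℓ) → identity ∈ C → DNR φ 3 ≤[ C ] DNR φ 2
    DNR₃≤DNR₂ C id∈C = identity , id∈C , (λ {g} _ → g , λ _ → refl) ,
      -- `DNR-local` carries membership from `g` to the pointwise equal result.
      λ g∈ e → DNR-mono (s≤s (s≤s z≤n)) (DNR-local λ i → _ , g∈ , e i)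

    identity-<ω : ⟨<ω,1⟩-Computable Φ identity
    identity-<ω = let e , Φe≐ = identity-index in
      suc e , λ {g} {h} p → e , ≤-refl , from (Φe≐ g h) p

    identity-ω : ⟨1,ω⟩-Computable Φ identity
    identity-ω = let e , Φe≐ = identity-index ; mkComputable c p = const-computable e in
      (λ _ → e) , (c , λ σ → p _) , λ {g} {h} q → e , (0 , λ _ _ → refl) , from (Φe≐ g h) q

corollary70 : ExcludedMiddle 0ℓ →
    (φ : ℕ → ℕₛ ⇀ ℕₛ) → IsEffectiveEnumeration φ →
    (Φ : ℕ → 𝓝 ⇀ 𝓝) → IsEffectiveEnumeration𝓝 Φ →
    (DNR φ 3 <[ ⟨<ω,1⟩-Computable Φ ] DNR φ 2) × (DNR φ 3 <[ ⟨1,ω⟩-Computable Φ ] DNR φ 2)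
corollary70 em φ φ-enum Φ Φ-enum =
  (DNR₃≤DNR₂ em φ φ-enum Φ Φ-enum _ (identity-<ω em φ φ-enum Φ Φ-enum) ,
   ¬DNR₂≤DNR₃-<ω em φ φ-enum Φ Φ-enum) ,
  (DNR₃≤DNR₂ em φ φ-enum Φ Φ-enum _ (identity-ω em φ φ-enum Φ Φ-enum) ,
   ¬DNR₂≤DNR₃-ω em φ φ-enum Φ Φ-enum)
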